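{- The convex closure of any non-trivial ball (a ball of positive radius, i.e. $\{u: d(u,x)\le\rho\}$ with $\rho\ge 1$ an integer) in a hypercube $\mathbb{H}_d$ is the whole space.
   Context: $\mathbb{H}_d$ is the hypercube: its points are the subsets of $\{1,\ldots,d\}$, with distance $d(\gamma,\gamma')=|\gamma\triangle\gamma'|$. For points $a,b$, $$\widehat{m}(a,b)=\{u: d(a,u)=\lfloor d(a,b)/2\rfloor,\ d(a,u)+d(u,b)=d(a,b)\}\cup\{u: d(a,u)=\lceil d(a,b)/2\rceil,\ d(a,u)+d(u,b)=d(a,b)\},$$ and $\widehat{m}(S,T)=\bigcup_{s\in S,t\in T}\widehat{m}(s,t)$. A set $S$ is convex if $\widehat{m}(S,S)\subseteq S$. The convex closure of a set is the smallest convex set containing it (the intersection of all convex sets containing it). -}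

module Defs where

open import Data.Bool.Base using (_xor_)
open import Data.Fin.Subset using (Subset; ∣_∣)
open import Data.Nat.Base using (ℕ; _+_; _≤_; ⌊_/2⌋; ⌈_/2⌉)
open import Data.Product.Base using (_×_; ∃-syntax)
open import Data.Vec.Base using (zipWith)
open import Level using (Level; 0ℓ; suc)
open import Relation.Binary.PropositionalEquality.Core using (_≡_)
open import Relation.Unary using (Pred; _∈_; _⊆_; _∪_)

private
  variable
    d : ℕ
    ℓ : Level

infixr 6 _△_

_△_ : Subset d → Subset d → Subset d
p △ q = zipWith _xor_ p q

-- Points of the hypercube; the ground set {1,…,d} is represented by Fin d.
ℍ : ℕ → Set
ℍ d = Subset d

dist : ℍ d → ℍ d → ℕ
dist γ γ′ = ∣ γ △ γ′ ∣

m̂ : ℍ d → ℍ d → Pred (ℍ d) 0ℓ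
m̂ a b =
    (λ u → dist a u ≡ ⌊ dist a b /2⌋ × dist a u + dist u b ≡ dist a b)
  ∪ (λ u → dist a u ≡ ⌈ dist a b /2⌉ × dist a u + dist u b ≡ dist a b)

m̂ₛ : Pred (ℍ d) ℓ → Pred (ℍ d) ℓ → Pred (ℍ d) ℓ
m̂ₛ S T u = ∃[ s ] ∃[ t ] (s ∈ S × t ∈ T × u ∈ m̂ s t)

Convex : Pred (ℍ d) ℓ → Set ℓ
Convex S = m̂ₛ S S ⊆ S

-- The intersection of all convex sets containing S. It ranges over arbitrary
-- (not necessarily decidable) predicates, so it lives one universe level up.
ConvexClosure : Pred (ℍ d) ℓ → Pred (ℍ d) (suc ℓ)
ConvexClosure {d} {ℓ} S u = (C : Pred (ℍ d) ℓ) → Convex C → S ⊆ C → u ∈ C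

Ball : ℍ d → ℕ → Pred (ℍ d) 0ℓ
Ball x ρ u = dist u x ≤ ρ

{-# OPTIONS --safe #-}

-- Write W = u △ x. If |W| ≥ 2, pick distinct i, j ∈ W: the points u △ {i} and u △ {j} are at
-- distance 2 from each other with u halfway between them, and both are one step closer to x than u.
-- Hence a convex set containing the ball of radius 1 around x contains all points, by induction on |W|.
module Submission where

open import Defs
open import Data.Bool.Base using (true; false)
open import Data.Nat.Base using (ℕ; suc; _≤_; z≤n)
open import Data.Nat.Properties using (≤-trans; ≤-reflexive; suc-injective)
open import Data.Product.Base using (_×_; _,_; ∃-syntax)
open import Data.Sum.Base using (inj₁)
open import Data.Vec.Base using ([]; _∷_)
open import Relation.Binary.PropositionalEquality using (_≡_; refl; cong)
open import Relation.Unary using (Pred; U; _≐_; _∈_; _⊆_)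

dist-refl : ∀ {d} (u : ℍ d) → dist u u ≡ 0
dist-refl []          = refl
dist-refl (true  ∷ u) = dist-refl u
dist-refl (false ∷ u) = dist-refl u

-- The witness is `u` with the first coordinate where it disagrees with `x` flipped.
step-towards : ∀ {d k} (u x : ℍ d) → dist u x ≡ suc k →
               ∃[ b ] (dist b x ≡ k × dist u b ≡ 1)
step-towards [] [] ()
step-towards (true ∷ u) (true ∷ x) eq with step-towards u x eq
... | b , bx , ub = true ∷ b , bx , ub
step-towards (false ∷ u) (false ∷ x) eq with step-towards u x eq
... | b , bx , ub = false ∷ b , bx , ub
step-towards (true ∷ u) (false ∷ x) eq =
  false ∷ u , suc-injective eq , cong suc (dist-refl u)
step-towards (false ∷ u) (true ∷ x) eq =
  true ∷ u , suc-injective eq , cong suc (dist-refl u)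

two-steps-towards : ∀ {d k} (u x : ℍ d) → dist u x ≡ suc (suc k) →
  ∃[ a ] ∃[ b ] (dist a x ≡ suc k × dist b x ≡ suc k ×
                 dist a u ≡ 1 × dist u b ≡ 1 × dist a b ≡ 2)
two-steps-towards [] [] ()
two-steps-towards (true ∷ u) (true ∷ x) eq with two-steps-towards u x eq
... | a , b , ds = true ∷ a , true ∷ b , ds
two-steps-towards (false ∷ u) (false ∷ x) eq with two-steps-towards u x eq
... | a , b , ds = false ∷ a , false ∷ b , ds
-- At the first disagreement, `a` flips the head, while `b` keeps it and flips a later coordinate
-- found in the tails. The two flips are distinct, whence `dist a b ≡ 2`.
two-steps-towards (true ∷ u) (false ∷ x) eq with step-towards u x (suc-injective eq)
... | b , bx , ub = false ∷ u , true ∷ b ,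
  suc-injective eq , cong suc bx , cong suc (dist-refl u) , ub , cong suc ub
two-steps-towards (false ∷ u) (true ∷ x) eq with step-towards u x (suc-injective eq)
... | b , bx , ub = true ∷ u , false ∷ b ,
  suc-injective eq , cong suc bx , cong suc (dist-refl u) , ub , cong suc ub

midpoint-of-distance-2 : ∀ {d} (a u b : ℍ d) →
  dist a u ≡ 1 → dist u b ≡ 1 → dist a b ≡ 2 → u ∈ m̂ a b
-- Half of 2 is exactly 1, so floor and ceiling agree and either side of the union would do.
midpoint-of-distance-2 a u b au ub ab rewrite au | ub | ab = inj₁ (refl , refl)

-- The distance is named `k` to make the recursion structural: `a` and `b` are not subterms of `u`.
convex⊇Ball₁-universal : ∀ {d ℓ} {x : ℍ d} (C : Pred (ℍ d) ℓ) → Convex C → Ball x 1 ⊆ C →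
                         ∀ k u → dist u x ≡ k → u ∈ C
convex⊇Ball₁-universal C convex ball 0 u eq = ball (≤-trans (≤-reflexive eq) z≤n)
-- Distance 1 is a base case too: with a single disagreement there is no second coordinate to flip
-- towards `x`.
convex⊇Ball₁-universal C convex ball 1 u eq = ball (≤-reflexive eq)
convex⊇Ball₁-universal {x = x} C convex ball (suc (suc k)) u eq =
  let a , b , ax , bx , au , ub , ab = two-steps-towards u x eq
  in convex (a , b ,
             convex⊇Ball₁-universal C convex ball (suc k) a ax ,
             convex⊇Ball₁-universal C convex ball (suc k) b bx ,
             midpoint-of-distance-2 a u b au ub ab)

corollary3p3 : ∀ (d : ℕ) (x : ℍ d) (ρ : ℕ) → 1 ≤ ρ → ConvexClosure (Ball x ρ) ≐ U
corollary3p3 d x ρ 1≤ρ =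
  (λ _ → _) ,
  λ {u} _ C convex ball →
    -- Positivity of `ρ` puts `Ball x 1` inside `Ball x ρ`, hence inside `C`.
    convex⊇Ball₁-universal C convex (λ u≤1 → ball (≤-trans u≤1 1≤ρ)) (dist u x) u refl
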